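{- Let $G$ be a linear oriented hypergraph with incidence dual $G^*$ and intersection graph $\Lambda(G)$. Then $A(G^*)=A(\Lambda(G))$.
   Context: A hypergraph $H=(V,E,\mathcal I)$ consists of a finite set $V$ of vertices, a finite family $E=(e_\iota)_{\iota\in\Omega}$ of subsets of $V$ (the edges; an edge may be empty, and edges with different indices are regarded as different even if they coincide as sets) and its incidences $\mathcal I$. All hypergraphs are simple: each vertex $v\in e$ is incident with $e$ exactly once, so $\mathcal I=\{(v,e): v\in e\}$. $H$ is linear if $|e\cap f|\le 1$ for any two edges $e,f$ with distinct indices. An oriented hypergraph is a pair $G=(H,\sigma)$ with $\sigma:\mathcal I\to\{+1,-1\}$; hypergraph terminology for $G$ refers to $H$. For an oriented hypergraph with vertices $v_1,\dots,v_n$, an edge $e$ and distinct $v_i,v_j\in e$, put $\mathrm{sgn}_e(v_i,v_j)=-\sigma(v_i,e)\sigma(v_j,e)$. The adjacency matrix $A=(a_{ij})\in\mathbb R^{n\times n}$ has $a_{ij}=\sum_{e}\mathrm{sgn}_e(v_i,v_j)$ for $i\ne j$, the sum being over all edges $e$ containing both $v_i$ and $v_j$ (so $a_{ij}=0$ if there are none), and $a_{ii}=0$. The incidence dual $G^*$ has vertex set $E$ and edge family $V$, where $e$ is incident with $v$ in $G^*$ iff $v$ is incident with $e$ in $G$; its orientation is $\sigma^*(e,v)=\sigma(v,e)$. Intersection graph: for a linear $G$, $\Lambda(G)$ is the oriented hypergraph with vertex set $E(G)$ (ordered as in $G^*$) and one edge $ef=\{e,f\}$ for each pair of distinct $e,f\in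 E(G)$ with $e\cap f\ne\varnothing$; if $v\in e\cap f$ then $\sigma_{\Lambda(G)}(e,ef)=\sigma_G(v,e)$ and $\sigma_{\Lambda(G)}(f,ef)=\sigma_G(v,f)$. -}

module Defs where

open import Algebra.Properties.CommutativeMonoid.Sum as Sum using ()
open import Data.Fin using (Fin; _<_; _<?_; _≟_)
open import Data.Fin.Subset using (Subset; _∈_; _∩_; _∪_; ⁅_⁆; ∣_∣; Nonempty)
open import Data.Fin.Subset.Properties
  using (_∈?_; nonempty?; x∈p∩q⁻; x∈p∪q⁻; x∈⁅y⁆⇒x≡y)
open import Data.Integer using (ℤ; 0ℤ; _◃_)
open import Data.Integer.Properties using (+-0-commutativeMonoid)
open import Data.List using (List; allFin; cartesianProduct; length; lookup; mapMaybe)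
open import Data.Maybe using (Maybe; just; nothing)
open import Data.Nat using (ℕ; _≤_)
open import Data.Product using (_×_; _,_; proj₁; proj₂)
open import Data.Sign using (Sign; opposite; _*_)
open import Data.Sum using (inj₁; inj₂)
import Data.Vec as Vec
open import Data.Vec.Properties using ([]=⇒lookup; lookup⇒[]=; lookup∘tabulate)
open import Relation.Binary.PropositionalEquality using (_≡_; _≢_; sym; trans)
open import Relation.Nullary using (yes; no)

open Sum +-0-commutativeMonoid using (sum)

-- n is the number of vertices and m the number of edge indices.  Edges form a
-- family, so distinct indices may carry the same subset.  The orientation is
-- defined on incidences only; v ∈ edge e has at most one proof, so each
-- incidence receives exactly one sign.
record OrientedHypergraph (n m : ℕ) : Set where
  field
    edge : Fin m → Subset n
    σ    : (v : Fin n) (e : Fin m) → v ∈ edge e → Sign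

open OrientedHypergraph public

Linear : ∀ {n m} → OrientedHypergraph n m → Set
Linear {m = m} G = (e f : Fin m) → e ≢ f → ∣ edge G e ∩ edge G f ∣ ≤ 1

sgn : ∀ {n m} (G : OrientedHypergraph n m) (e : Fin m) (v w : Fin n) →
      v ∈ edge G e → w ∈ edge G e → Sign
sgn G e v w v∈e w∈e = opposite (σ G v e v∈e * σ G w e w∈e)

-- The summand of a_{vw} at the edge e: zero unless e contains both v and w.
contribution : ∀ {n m} → OrientedHypergraph n m → Fin n → Fin n → Fin m → ℤ
contribution G v w e with v ∈? edge G e | w ∈? edge G e
... | yes v∈e | yes w∈e = sgn G e v w v∈e w∈e ◃ 1
... | _       | _       = 0ℤ

-- All entries of the adjacency matrix are integers.
adjacencyMatrix : ∀ {n m} → OrientedHypergraph n m → Fin n → Fin n → ℤ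
adjacencyMatrix G v w with v ≟ w
... | yes _ = 0ℤ
... | no  _ = sum (contribution G v w)

dualEdge : ∀ {n m} → OrientedHypergraph n m → Fin n → Subset m
dualEdge G v = Vec.tabulate (λ e → Vec.lookup (edge G e) v)

∈-dualEdge⁻ : ∀ {n m} (G : OrientedHypergraph n m) {v : Fin n} {e : Fin m} →
              e ∈ dualEdge G v → v ∈ edge G e
∈-dualEdge⁻ G {v} {e} e∈v = lookup⇒[]= v (edge G e)
  (trans (sym (lookup∘tabulate (λ e′ → Vec.lookup (edge G e′) v) e))
         ([]=⇒lookup e∈v))

infix 9 _⋆

_⋆ : ∀ {n m} → OrientedHypergraph n m → OrientedHypergraph m n
edge (G ⋆)         = dualEdge G
σ    (G ⋆) e v e∈v = σ G v e (∈-dualEdge⁻ G e∈v)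

-- An unordered pair of distinct intersecting edges, represented by its
-- increasing ordering of indices, with a vertex in the intersection.
record IntersectingPair {n m : ℕ} (G : OrientedHypergraph n m) : Set where
  constructor pair
  field
    e f  : Fin m
    e<f  : e < f
    meet : Nonempty (edge G e ∩ edge G f)

  ends : Subset m
  ends = ⁅ e ⁆ ∪ ⁅ f ⁆

  common : Fin n
  common = proj₁ meet

  common∈ : ∀ {x} → x ∈ ends → common ∈ edge G x
  common∈ x∈ends with x∈p∪q⁻ ⁅ e ⁆ ⁅ f ⁆ x∈ends
  ... | inj₁ x∈⁅e⁆ rewrite x∈⁅y⁆⇒x≡y e x∈⁅e⁆ =
    proj₁ (x∈p∩q⁻ (edge G e) (edge G f) (proj₂ meet))
  ... | inj₂ x∈⁅f⁆ rewrite x∈⁅y⁆⇒x≡y f x∈⁅f⁆ =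
    proj₂ (x∈p∩q⁻ (edge G e) (edge G f) (proj₂ meet))

open IntersectingPair public using (ends; common; common∈)

intersectingPair? : ∀ {n m} (G : OrientedHypergraph n m) →
                    Fin m × Fin m → Maybe (IntersectingPair G)
intersectingPair? G (e , f) with e <? f | nonempty? (edge G e ∩ edge G f)
... | yes e<f | yes meet = just (pair e f e<f meet)
... | _       | _        = nothing

-- Each unordered pair {e , f} of distinct intersecting edges occurs exactly once.
intersectingPairs : ∀ {n m} (G : OrientedHypergraph n m) → List (IntersectingPair G)
intersectingPairs {m = m} G =
  mapMaybe (intersectingPair? G) (cartesianProduct (allFin m) (allFin m))

-- By linearity, common is the only vertex in the intersection of the two
-- edges, so the orientation does not depend on the vertex chosen in meet.
Λ : ∀ {n m} (G : OrientedHypergraph n m) → Linear G →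
    OrientedHypergraph m (length (intersectingPairs G))
edge (Λ G _) k         = ends (lookup (intersectingPairs G) k)
σ    (Λ G _) x k x∈ends = σ G (common ef) x (common∈ ef x∈ends)
  where ef = lookup (intersectingPairs G) k

{-# OPTIONS --safe #-}

-- For distinct edges e and f, each of the two entries at (e , f) is a sum with
-- at most one nonzero term: linearity leaves at most one vertex in e ∩ f, and
-- Λ(G) has at most one edge whose ends are e and f.  Both terms are present
-- exactly when e ∩ f is nonempty, and then both are −σ(v,e)σ(v,f) for the common
-- vertex v.
module Submission where

open import Defs
open import Algebra.Properties.CommutativeMonoid.Sum as Sum using ()
open import Data.Fin using (Fin; zero; suc; _<_; _<?_; _≟_)
open import Data.Fin.Properties using (<-cmp; <-irrefl; <-asym; punchInᵢ≢i)
open import Data.Fin.Subset using (Subset; _∈_; _∩_; ⁅_⁆; ∣_∣; Nonempty)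
open import Data.Fin.Subset.Properties
  using (_∈?_; nonempty?; x∈p∩q⁺; x∈p∩q⁻; x∈p∪q⁺; x∈p∪q⁻; x∈⁅x⁆; x∈⁅y⁆⇒x≡y;
         x∈p⇒∣p-x∣<∣p∣; x∈p∧x≢y⇒x∈p-y)
open import Data.Integer using (ℤ; 0ℤ; _+_; _◃_)
open import Data.Integer.Properties using (+-0-commutativeMonoid; +-identityʳ)
open import Data.List using (List; allFin; lookup; mapMaybe)
open import Data.List.Membership.Propositional.Properties
  using (∈-allFin; ∈-cartesianProduct⁺; ∈-lookup)
import Data.List.Relation.Unary.All as All
import Data.List.Relation.Unary.All.Properties as All
open import Data.List.Relation.Unary.AllPairs using (AllPairs; []; _∷_)
open import Data.List.Relation.Unary.Any as Any using (Any)
import Data.List.Relation.Unary.Any.Properties as Any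
open import Data.List.Relation.Unary.Unique.Propositional.Properties
  using (allFin⁺; cartesianProduct⁺)
open import Data.Maybe using (Maybe; just; nothing)
import Data.Maybe.Relation.Unary.All as MAll
import Data.Maybe.Relation.Unary.Any as MAny
open import Data.Nat using (ℕ; suc; z≤n; s≤s; _≤_)
import Data.Nat.Properties as ℕ
open import Data.Product using (_×_; _,_; proj₁; proj₂; ∃)
open import Data.Sign using (opposite; _*_)
open import Data.Sign.Properties using (*-comm)
open import Data.Sum using (inj₁; inj₂)
open import Data.Vec using (here; there)
open import Data.Vec.Properties using ([]=⇒lookup; lookup⇒[]=; lookup∘tabulate)
open import Function using (_on_)
open import Relation.Binary using (Rel; tri<; tri≈; tri>)
open import Relation.Binary.PropositionalEquality
  using (_≡_; _≢_; refl; sym; trans; cong; cong₂; module ≡-Reasoning)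
open import Relation.Nullary using (¬_; yes; no; contradiction)

open Sum +-0-commutativeMonoid using (sum; sum-cong-≗; sum-remove; sum-replicate-zero)

sum-zero : ∀ {n} {t : Fin n → ℤ} → (∀ i → t i ≡ 0ℤ) → sum t ≡ 0ℤ
sum-zero {n} t≡0 = trans (sum-cong-≗ t≡0) (sum-replicate-zero n)

-- Splitting off the term at `i` leaves a sum over the indices `punchIn i j`, all of them different
-- from `i`.
sum-single : ∀ {n} {t : Fin n → ℤ} (i : Fin n) → (∀ j → j ≢ i → t j ≡ 0ℤ) → sum t ≡ t i
sum-single {suc n} {t} i t≡0 = begin
  sum t      ≡⟨ sum-remove {i = i} t ⟩
  t i + _    ≡⟨ cong (t i +_) (sum-zero λ j → t≡0 _ (punchInᵢ≢i i j)) ⟩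
  t i + 0ℤ   ≡⟨ +-identityʳ (t i) ⟩
  t i        ∎
  where open ≡-Reasoning

-- An orientation takes a membership proof as argument, so two signs at one incidence agree only
-- after their proofs are identified.
∈-irrelevant : ∀ {n} {x : Fin n} {p : Subset n} (x∈p x∈p′ : x ∈ p) → x∈p ≡ x∈p′
∈-irrelevant here        here         = refl
∈-irrelevant (there x∈p) (there x∈p′) = cong there (∈-irrelevant x∈p x∈p′)

∣p∣≤1⇒x≡y : ∀ {n} {p : Subset n} {x y} → ∣ p ∣ ≤ 1 → x ∈ p → y ∈ p → x ≡ y
∣p∣≤1⇒x≡y {p = p} {x} {y} ∣p∣≤1 x∈p y∈p with x ≟ y
... | yes x≡y = x≡y
-- Deleting `y` brings the cardinality below 1, yet `x` survives the deletion and keeps it at least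
-- 1.
... | no  x≢y = contradiction
  (ℕ.≤-trans (x∈p⇒∣p-x∣<∣p∣ y∈p) ∣p∣≤1)
  (ℕ.≤⇒≯ (ℕ.≤-trans (s≤s z≤n) (x∈p⇒∣p-x∣<∣p∣ (x∈p∧x≢y⇒x∈p-y x∈p x≢y))))

module _ {a b r s} {A : Set a} {B : Set b} {R : Rel A r} {S : Rel B s} {p : A → Maybe B} where

  -- The equations `p x ≡ just u` and `p y ≡ just v` are kept in the premise so that `S u v` can be
  -- derived by tracing `u` and `v` back to their arguments.
  AllPairs-mapMaybe⁺ : (∀ {x y u v} → p x ≡ just u → p y ≡ just v → R x y → S u v) →
                       ∀ {xs} → AllPairs R xs → AllPairs S (mapMaybe p xs)
  AllPairs-mapMaybe⁺ R⇒S []                    = []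
  AllPairs-mapMaybe⁺ R⇒S (_∷_ {x} {xs} xRs Rs) with p x in px≡u
  ... | nothing = AllPairs-mapMaybe⁺ R⇒S Rs
  ... | just u  = All.mapMaybe⁺ (All.map⁺ (All.map uS xRs)) ∷ AllPairs-mapMaybe⁺ R⇒S Rs
    where
    uS : ∀ {y} → R x y → MAll.All (S u) (p y)
    uS {y} xRy with p y in py≡v
    ... | nothing = MAll.nothing
    ... | just v  = MAll.just (R⇒S px≡u py≡v xRy)

-- Entries are compared through `f` so that intersecting pairs can be told apart by their indices,
-- without comparing the vertices and proofs they carry.
lookup-injective-on : ∀ {a b} {A : Set a} {B : Set b} {f : A → B} {xs : List A} →
                      AllPairs (_≢_ on f) xs →
                      ∀ i j → f (lookup xs i) ≡ f (lookup xs j) → i ≡ j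
lookup-injective-on (_   ∷ _)  zero    zero    eq = refl
lookup-injective-on (x≢s ∷ _)  zero    (suc j) eq =
  contradiction eq (All.lookup x≢s (∈-lookup j))
lookup-injective-on (x≢s ∷ _)  (suc i) zero    eq =
  contradiction (sym eq) (All.lookup x≢s (∈-lookup i))
lookup-injective-on (_   ∷ xs) (suc i) (suc j) eq = cong suc (lookup-injective-on xs i j eq)

module _ {n m} (G : OrientedHypergraph n m) where

  σ-cong : ∀ {v w e} {v∈e : v ∈ edge G e} {w∈e : w ∈ edge G e} →
           v ≡ w → σ G v e v∈e ≡ σ G w e w∈e
  σ-cong refl = cong (σ G _ _) (∈-irrelevant _ _)

  contribution-∈ : ∀ {v w e} (v∈e : v ∈ edge G e) (w∈e : w ∈ edge G e) →
                   contribution G v w e ≡ sgn G e v w v∈e w∈e ◃ 1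
  contribution-∈ {v} {w} {e} v∈e w∈e with v ∈? edge G e | w ∈? edge G e
  ... | yes p | yes q = cong₂ (λ p q → sgn G e v w p q ◃ 1)
    (∈-irrelevant p v∈e) (∈-irrelevant q w∈e)
  ... | yes _ | no w∉ = contradiction w∈e w∉
  ... | no v∉ | _     = contradiction v∈e v∉

  contribution-∉ : ∀ {v w e} → ¬ (v ∈ edge G e × w ∈ edge G e) → contribution G v w e ≡ 0ℤ
  contribution-∉ {v} {w} {e} ∉e with v ∈? edge G e | w ∈? edge G e
  ... | yes p | yes q = contradiction (p , q) ∉e
  ... | yes _ | no  _ = refl
  ... | no  _ | _     = refl

  contribution-comm : ∀ v w e → contribution G v w e ≡ contribution G w v e
  contribution-comm v w e with v ∈? edge G e | w ∈? edge G e
  ... | yes p | yes q = cong (λ s → opposite s ◃ 1) (*-comm (σ G v e p) (σ G w e q))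
  ... | yes _ | no  _ = refl
  ... | no  _ | yes _ = refl
  ... | no  _ | no  _ = refl

module _ {n m} {G : OrientedHypergraph n m} where

  ∈-dualEdge⁺ : ∀ {v e} → v ∈ edge G e → e ∈ dualEdge G v
  ∈-dualEdge⁺ {v} {e} v∈e =
    lookup⇒[]= e (dualEdge G v) (trans (lookup∘tabulate _ e) ([]=⇒lookup v∈e))

  indices : IntersectingPair G → Fin m × Fin m
  indices (pair e f _ _) = e , f

  indices-ends : ∀ {e f} (p : IntersectingPair G) → indices p ≡ (e , f) →
                 e ∈ ends p × f ∈ ends p
  indices-ends (pair e f _ _) refl = x∈p∪q⁺ (inj₁ (x∈⁅x⁆ e)) , x∈p∪q⁺ (inj₂ (x∈⁅x⁆ f))

  -- Two distinct elements of a two-element set exhaust it, and since both pairs are increasing,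
  -- only the order-preserving matching remains.
  ends-indices : ∀ {e f} (p : IntersectingPair G) → e < f →
                 e ∈ ends p → f ∈ ends p → indices p ≡ (e , f)
  ends-indices (pair e′ f′ e′<f′ _) e<f e∈ f∈
    with x∈p∪q⁻ ⁅ e′ ⁆ ⁅ f′ ⁆ e∈ | x∈p∪q⁻ ⁅ e′ ⁆ ⁅ f′ ⁆ f∈
  ... | inj₁ e∈e′ | inj₂ f∈f′ = sym (cong₂ _,_ (x∈⁅y⁆⇒x≡y e′ e∈e′) (x∈⁅y⁆⇒x≡y f′ f∈f′))
  ... | inj₁ e∈e′ | inj₁ f∈e′ =
    contradiction e<f (<-irrefl (trans (x∈⁅y⁆⇒x≡y e′ e∈e′) (sym (x∈⁅y⁆⇒x≡y e′ f∈e′))))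
  ... | inj₂ e∈f′ | inj₂ f∈f′ =
    contradiction e<f (<-irrefl (trans (x∈⁅y⁆⇒x≡y f′ e∈f′) (sym (x∈⁅y⁆⇒x≡y f′ f∈f′))))
  -- The crossed matching makes `e < f` the reverse of `e′ < f′`.
  ... | inj₂ e∈f′ | inj₁ f∈e′ with refl ← x∈⁅y⁆⇒x≡y f′ e∈f′ | refl ← x∈⁅y⁆⇒x≡y e′ f∈e′ =
    contradiction e<f (<-asym e′<f′)

  indices-meet : ∀ {e f} (p : IntersectingPair G) → indices p ≡ (e , f) →
                 Nonempty (edge G e ∩ edge G f)
  indices-meet (pair _ _ _ meet) refl = meet

  intersectingPair?-indices : ∀ {x p} → intersectingPair? G x ≡ just p → indices p ≡ x
  intersectingPair?-indices {e , f} eq with e <? f | nonempty? (edge G e ∩ edge G f) | eq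
  ... | yes _ | yes _ | refl = refl

  -- Only the indices are fixed: `nonempty?` may find a vertex other than the one in the given
  -- `meet`.
  intersectingPair?-defined : ∀ {e f} → e < f → Nonempty (edge G e ∩ edge G f) →
    MAny.Any (λ p → indices p ≡ (e , f)) (intersectingPair? G (e , f))
  intersectingPair?-defined {e} {f} e<f meet with e <? f | nonempty? (edge G e ∩ edge G f)
  ... | yes _   | yes _     = MAny.just refl
  ... | yes _   | no  ¬meet = contradiction meet ¬meet
  ... | no  e≮f | _         = contradiction e<f e≮f

  -- The product list has no repetition, and every pair produced has as its indices the very
  -- argument that produced it.
  intersectingPairs-unique : AllPairs (_≢_ on indices) (intersectingPairs G)
  intersectingPairs-unique = AllPairs-mapMaybe⁺
    (λ px≡u py≡v x≢y u≡v → x≢y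
      (trans (sym (intersectingPair?-indices px≡u)) (trans u≡v (intersectingPair?-indices py≡v))))
    (cartesianProduct⁺ (allFin⁺ m) (allFin⁺ m))

  intersectingPairs-complete : ∀ {e f} → e < f → Nonempty (edge G e ∩ edge G f) →
    ∃ λ k → indices (lookup (intersectingPairs G) k) ≡ (e , f)
  intersectingPairs-complete {e} {f} e<f meet = Any.index any , Any.lookup-index any
    where
    any : Any (λ p → indices p ≡ (e , f)) (intersectingPairs G)
    any = Any.mapMaybe⁺ (intersectingPair? G) _ (Any.map⁺
      (Any.map (λ { refl → intersectingPair?-defined e<f meet })
        (∈-cartesianProduct⁺ (∈-allFin e) (∈-allFin f))))

  module _ (lin : Linear G) {e f : Fin m} (e<f : e < f) where

    private
      ef : ∀ k → IntersectingPair G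
      ef = lookup (intersectingPairs G)

    -- Every term vanishes on both sides: a dual edge containing `e` and `f` is itself a common
    -- vertex, and an edge of `Λ G lin` containing them stores one in `meet`.
    sum-contribution-disjoint : ¬ Nonempty (edge G e ∩ edge G f) →
      sum (contribution (G ⋆) e f) ≡ sum (contribution (Λ G lin) e f)
    sum-contribution-disjoint disjoint = trans
      (sum-zero λ v → contribution-∉ (G ⋆) λ (e∈v , f∈v) →
        disjoint (v , x∈p∩q⁺ (∈-dualEdge⁻ G e∈v , ∈-dualEdge⁻ G f∈v)))
      (sym (sum-zero λ k → contribution-∉ (Λ G lin) λ (e∈k , f∈k) →
        disjoint (indices-meet (ef k) (ends-indices (ef k) e<f e∈k f∈k))))

    sum-contribution-meet : Nonempty (edge G e ∩ edge G f) →
      sum (contribution (G ⋆) e f) ≡ sum (contribution (Λ G lin) e f)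
    sum-contribution-meet meet@(v , v∈e∩f) with intersectingPairs-complete e<f meet
    ... | k , efₖ≡e,f = begin
      sum (contribution (G ⋆) e f)            ≡⟨ sum-single v ⋆-vanishes ⟩
      contribution (G ⋆) e f v                ≡⟨ contribution-∈ (G ⋆) e∈v f∈v ⟩
      -- The left signs are taken at the given vertex `v`, the right ones at the vertex stored in
      -- the `k`-th pair; linearity makes these vertices equal.
      sgn (G ⋆) v e f e∈v f∈v ◃ 1             ≡⟨ cong₂ (λ s t → opposite (s * t) ◃ 1)
                                                   (σ-cong G v≡common) (σ-cong G v≡common) ⟩
      sgn (Λ G lin) k e f e∈k f∈k ◃ 1         ≡⟨ contribution-∈ (Λ G lin) e∈k f∈k ⟨
      contribution (Λ G lin) e f k            ≡⟨ sum-single k Λ-vanishes ⟨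
      sum (contribution (Λ G lin) e f)        ∎
      where
      open ≡-Reasoning

      e∈v : e ∈ dualEdge G v
      e∈v = ∈-dualEdge⁺ (proj₁ (x∈p∩q⁻ _ _ v∈e∩f))

      f∈v : f ∈ dualEdge G v
      f∈v = ∈-dualEdge⁺ (proj₂ (x∈p∩q⁻ _ _ v∈e∩f))

      e∈k : e ∈ ends (ef k)
      e∈k = proj₁ (indices-ends (ef k) efₖ≡e,f)

      f∈k : f ∈ ends (ef k)
      f∈k = proj₂ (indices-ends (ef k) efₖ≡e,f)

      -- Linearity applies because `e < f` makes the two indices distinct.
      v-unique : ∀ {w} → w ∈ edge G e → w ∈ edge G f → v ≡ w
      v-unique w∈e w∈f =
        ∣p∣≤1⇒x≡y (lin e f λ e≡f → <-irrefl e≡f e<f) v∈e∩f (x∈p∩q⁺ (w∈e , w∈f))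

      v≡common : v ≡ common (ef k)
      v≡common = v-unique (common∈ (ef k) e∈k) (common∈ (ef k) f∈k)

      ⋆-vanishes : ∀ w → w ≢ v → contribution (G ⋆) e f w ≡ 0ℤ
      ⋆-vanishes w w≢v = contribution-∉ (G ⋆) λ (e∈w , f∈w) →
        w≢v (sym (v-unique (∈-dualEdge⁻ G e∈w) (∈-dualEdge⁻ G f∈w)))

      Λ-vanishes : ∀ l → l ≢ k → contribution (Λ G lin) e f l ≡ 0ℤ
      -- An edge containing both `e` and `f` has indices `(e , f)`, as the `k`-th does, so it sits
      -- at position `k`.
      Λ-vanishes l l≢k = contribution-∉ (Λ G lin) λ (e∈l , f∈l) →
        l≢k (lookup-injective-on intersectingPairs-unique l k
          (trans (ends-indices (ef l) e<f e∈l f∈l) (sym efₖ≡e,f)))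

    sum-contribution-⋆≡Λ : sum (contribution (G ⋆) e f) ≡ sum (contribution (Λ G lin) e f)
    sum-contribution-⋆≡Λ with nonempty? (edge G e ∩ edge G f)
    ... | yes meet    = sum-contribution-meet meet
    ... | no disjoint = sum-contribution-disjoint disjoint

corollary4p2 : (n m : ℕ) (G : OrientedHypergraph n m) (lin : Linear G) →
    (e f : Fin m) → adjacencyMatrix (G ⋆) e f ≡ adjacencyMatrix (Λ G lin) e f
corollary4p2 n m G lin e f with e ≟ f
-- Both diagonals are zero by definition.
... | yes _ = refl
... | no e≢f with <-cmp e f
...   | tri< e<f _ _ = sum-contribution-⋆≡Λ lin e<f
...   | tri≈ _ e≡f _ = contradiction e≡f e≢f
-- Intersecting pairs are stored in increasing order, so the remaining case is reached by exchanging
-- `e` and `f` in both sums.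
...   | tri> _ _ f<e = begin
  sum (contribution (G ⋆) e f)        ≡⟨ sum-cong-≗ (contribution-comm (G ⋆) e f) ⟩
  sum (contribution (G ⋆) f e)        ≡⟨ sum-contribution-⋆≡Λ lin f<e ⟩
  sum (contribution (Λ G lin) f e)    ≡⟨ sum-cong-≗ (contribution-comm (Λ G lin) f e) ⟩
  sum (contribution (Λ G lin) e f)    ∎
  where open ≡-Reasoning
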